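{- Let $H$ be an $n$-vertex graph and let $G$ be a graph obtained from $H$ by subdividing each edge of $H$ at least $2\log_2 n$ times (i.e., replacing each edge by a path with at least $2\log_2 n$ internal vertices). Then $tww(G)\leqslant 4$.
   Context: A trigraph $G$ consists of a vertex set $V(G)$ and two disjoint sets of unordered pairs of distinct vertices: black edges $E(G)$ and red edges $R(G)$; a graph is a trigraph with no red edge. The red degree of a vertex is the number of red edges incident to it. Contracting two distinct vertices $u,v$ of a trigraph replaces them by a single new vertex $w$ such that, for every other vertex $z$, $wz$ is a black edge if $uz$ and $vz$ are both black edges, $wz$ is a non-edge if $uz$ and $vz$ are both non-edges, and $wz$ is a red edge otherwise; the rest of the trigraph is unchanged. A contraction sequence from an $n$-vertex trigraph $G$ is a sequence $G=G_n,\dots,G_1$ in which each $G_{j}$ is obtained from $G_{j+1}$ by one contraction. A $d$-sequence is a contraction sequence in which every trigraph has maximum red degree at most $d$. The twin-width $tww(G)$ is the least $d$ such that $G$ admits a $d$-sequence. -}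

module Defs where

open import Data.Nat using (ℕ; zero; suc; _≤_; z≤n; s≤s; _≤?_)
open import Data.Nat.Properties using (≤-trans; ≤-reflexive; ≤-refl; n≤1+n)
open import Data.Fin using (Fin; zero; suc; toℕ; punchIn)
import Data.Fin as Fin
open import Data.Fin.Properties using (_≟_; all?; any?)
open import Data.List using (length; filter; allFin)
open import Data.List.Properties using (length-filter; length-tabulate)
open import Data.Product using (∃; _×_; _,_; proj₁; proj₂)
open import Data.Sum using (_⊎_)
open import Function using (id; _↔_; _⇔_; Inverse)
open import Relation.Nullary using (Dec; yes; no; contradiction)
open import Relation.Nullary.Decidable using (¬?; _×-dec_; map′)
open import Relation.Binary.PropositionalEquality using (_≡_; _≢_; refl)

data Status : Set where
  nonedge black red : Status

red? : (s : Status) → Dec (s ≡ red)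
red? nonedge = no λ ()
red? black   = no λ ()
red? red     = yes refl

-- E(G) and R(G) are the pairs of status black and red respectively; giving each
-- pair a single status makes the two sets disjoint.
record Trigraph (n : ℕ) : Set where
  field
    status     : Fin n → Fin n → Status
    status-sym : ∀ u v → status u v ≡ status v u
    loopless   : ∀ u → status u u ≡ nonedge

open Trigraph public

IsGraph : ∀ {n} → Trigraph n → Set
IsGraph G = ∀ u v → status G u v ≢ red

redDegree : ∀ {n} → Trigraph n → Fin n → ℕ
redDegree {n} G u = length (filter (λ v → red? (status G u v)) (allFin n))

MaxRedDegree≤ : ∀ {n} → ℕ → Trigraph n → Set
MaxRedDegree≤ d G = ∀ u → redDegree G u ≤ d

merge : Status → Status → Status
merge black   black   = black
merge nonedge nonedge = nonedge
merge _       _       = red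

module _ {n : ℕ} (G : Trigraph n) (u v : Fin n) where

  -- Statuses after contracting u and v, where the new vertex is again called u.
  -- The vertex v is still present here; contract removes it.
  mergedStatus : Fin n → Fin n → Status
  mergedStatus x y with x ≟ u | y ≟ u
  ... | yes _ | yes _ = nonedge
  ... | yes _ | no  _ = merge (status G u y) (status G v y)
  ... | no  _ | yes _ = merge (status G u x) (status G v x)
  ... | no  _ | no  _ = status G x y

  mergedStatus-sym : ∀ x y → mergedStatus x y ≡ mergedStatus y x
  mergedStatus-sym x y with x ≟ u | y ≟ u
  ... | yes _ | yes _ = refl
  ... | yes _ | no  _ = refl
  ... | no  _ | yes _ = refl
  ... | no  _ | no  _ = status-sym G x y

  mergedStatus-loopless : ∀ x → mergedStatus x x ≡ nonedge
  mergedStatus-loopless x with x ≟ u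
  ... | yes _ = refl
  ... | no  _ = loopless G x

-- The contraction of u and v; only meaningful when u ≢ v. The vertex i of the
-- result stands for the vertex punchIn v i of G, with u standing for the new vertex.
contract : ∀ {n} → Trigraph (suc n) → (u v : Fin (suc n)) → Trigraph n
contract G u v = record
  { status     = λ i j → mergedStatus G u v (punchIn v i) (punchIn v j)
  ; status-sym = λ i j → mergedStatus-sym G u v (punchIn v i) (punchIn v j)
  ; loopless   = λ i → mergedStatus-loopless G u v (punchIn v i)
  }

data DSequence (d : ℕ) : ∀ {n} → Trigraph (suc n) → Set where
  end  : {G : Trigraph 1} → MaxRedDegree≤ d G → DSequence d G
  step : ∀ {n} {G : Trigraph (suc (suc n))} → MaxRedDegree≤ d G →
         ∀ u v → u ≢ v → DSequence d (contract G u v) → DSequence d G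

maxRedDegree≤? : ∀ {n} d (G : Trigraph n) → Dec (MaxRedDegree≤ d G)
maxRedDegree≤? d G = all? λ u → redDegree G u ≤? d

dSequence? : ∀ d {n} (G : Trigraph (suc n)) → Dec (DSequence d G)
dSequence? d {zero}  G = map′ end (λ { (end b) → b }) (maxRedDegree≤? d G)
dSequence? d {suc n} G =
  map′ (λ { (b , u , v , u≢v , s) → step b u v u≢v s })
       (λ { (step b u v u≢v s) → b , u , v , u≢v , s })
       (maxRedDegree≤? d G ×-dec
        any? λ u → any? λ v → ¬? (u ≟ v) ×-dec dSequence? d (contract G u v))

redDegree≤n : ∀ {n} (G : Trigraph n) u → redDegree G u ≤ n
redDegree≤n {n} G u =
  ≤-trans (length-filter (λ v → red? (status G u v)) (allFin n))
          (≤-reflexive (length-tabulate id))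

trivialSequence : ∀ d {n} → suc n ≤ d → (G : Trigraph (suc n)) → DSequence d G
trivialSequence d {zero}  n≤d G = end λ u → ≤-trans (redDegree≤n G u) n≤d
trivialSequence d {suc n} n≤d G =
  step (λ u → ≤-trans (redDegree≤n G u) n≤d) zero (suc zero) (λ ())
       (trivialSequence d (≤-trans (n≤1+n (suc n)) n≤d) _)

Least : (ℕ → Set) → ℕ → Set
Least P t = P t × (∀ d → P d → t ≤ d)

least : {P : ℕ → Set} → (∀ d → Dec (P d)) → ∀ b → P b → ∃ (Least P)
least P? zero    p = zero , p , λ _ _ → z≤n
least P? (suc b) p with P? zero
... | yes p₀ = zero , p₀ , λ _ _ → z≤n
... | no ¬p₀ with least (λ d → P? (suc d)) b p
... | t , pt , min = suc t , pt , λ { zero q → contradiction q ¬p₀ ; (suc d) q → s≤s (min d q) }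

leastWidth : ∀ {n} (G : Trigraph (suc n)) → ∃ (Least (λ d → DSequence d G))
leastWidth {n} G = least (λ d → dSequence? d G) (suc n) (trivialSequence (suc n) ≤-refl G)

-- Having a d-sequence is decidable and every nonempty trigraph has one for some d,
-- so the least such d can be computed.
tww : ∀ {n} → Trigraph (suc n) → ℕ
tww G = proj₁ (leastWidth G)

tww-sequence : ∀ {n} (G : Trigraph (suc n)) → DSequence (tww G) G
tww-sequence G = proj₁ (proj₂ (leastWidth G))

tww-least : ∀ {n} (G : Trigraph (suc n)) d → DSequence d G → tww G ≤ d
tww-least G = proj₂ (proj₂ (leastWidth G))

-- An unordered edge is represented by its increasing pair of endpoints; the proof
-- fields are irrelevant, so that the endpoints determine the edge.
record Edge {n : ℕ} (H : Trigraph n) : Set where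
  constructor edge
  field
    src tgt  : Fin n
    .src<tgt : src Fin.< tgt
    .isEdge  : status H src tgt ≡ black

open Edge public

module _ {n : ℕ} (H : Trigraph n) (len : Edge H → ℕ) where

  -- Each edge e is replaced by the path
  --   src e, inner e 0, …, inner e (len e - 1), tgt e.
  data SubdivisionVertex : Set where
    original : Fin n → SubdivisionVertex
    inner    : (e : Edge H) → Fin (len e) → SubdivisionVertex

  -- y directly follows x on the path replacing some edge.
  data Follows : (x y : SubdivisionVertex) → Set where
    direct : ∀ e → len e ≡ 0 → Follows (original (src e)) (original (tgt e))
    first  : ∀ e i → toℕ i ≡ 0 → Follows (original (src e)) (inner e i)
    next   : ∀ e i j → toℕ j ≡ suc (toℕ i) → Follows (inner e i) (inner e j)
    last   : ∀ e i → suc (toℕ i) ≡ len e → Follows (inner e i) (original (tgt e))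

  -- G is, up to the naming of its vertices, the graph obtained from H by
  -- subdividing every edge e exactly len e times.
  record IsSubdivision {m : ℕ} (G : Trigraph m) : Set where
    field
      vertices : SubdivisionVertex ↔ Fin m
      adjacent : ∀ x y →
        status G (Inverse.to vertices x) (Inverse.to vertices y) ≡ black
          ⇔ (Follows x y ⊎ Follows y x)

{-# OPTIONS --safe #-}
-- Let d be the rounded-up binary logarithm of n, and put the n original vertices on the
-- leaves of a binary tree of depth d with red edges. A subdivided edge uv has at least
-- 2d - 1 inner vertices, as many as the tree path from u up to the root and down to v, so
-- its inner vertices can be contracted one after the other onto tree nodes, from u to v,
-- such that consecutive ones land on equal or adjacent nodes. Meanwhile a tree node has
-- red edges only to its at most three tree neighbours and to the next inner vertex to be
-- contracted: at most four. Once all edges are folded only the red tree is left, which is contracted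
-- node by node into parents. Tree nodes to which no vertex has been sent simply do not exist yet.
module Submission where

open import Data.Bool using (true; T; false; if_then_else_)
open import Data.Empty using (⊥-elim)
open import Data.Fin using (Fin; zero; suc; toℕ; punchIn; combine; inject≤)
open import Data.Fin.Properties
  using (_≟_; any?; punchIn-injective; punchInᵢ≢i; injective⇒≤; toℕ-injective; toℕ<n;
         toℕ-combine; combine-injective; toℕ-inject≤)
open import Data.List using (List; []; _∷_; length; lookup; map; _++_; allFin)
open import Data.List.Properties using (length-map)
open import Data.List.Membership.Propositional using (_∈_)
open import Data.List.Membership.Propositional.Properties using (∈-lookup; ∈-filter⁻; ∈-map⁺; ∈-++⁺ˡ; ∈-++⁺ʳ)
open import Data.List.Membership.Setoid.Properties using (index-injective)
open import Data.List.Relation.Unary.All as All using ()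
open import Data.List.Relation.Unary.AllPairs using (_∷_)
open import Data.List.Relation.Unary.Any using (here; there; index)
open import Data.List.Relation.Unary.Unique.Propositional using (Unique)
import Data.List.Relation.Unary.Unique.Propositional.Properties as Unique
open import Data.Nat using (ℕ; zero; suc; pred; >-nonZero; _+_; _*_; _∸_; _^_;
         _≤_; _<_; _≤′_; ≤′-refl; ≤′-step; _≤ᵇ_; _≤?_; z≤n; s≤s; ⌊_/2⌋)
import Data.Nat.Properties as ℕ
open import Data.Product using (∃; ∃₂; _×_; _,_; proj₁; proj₂)
open import Data.Sum using (_⊎_; inj₁; inj₂)
open import Data.Sum.Properties using (≡-dec; inj₁-injective)
open import Function using (_∘_; id; Inverse; Equivalence)
open import Relation.Binary using (DecidableEquality; tri<; tri≈; tri>)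
open import Relation.Binary.PropositionalEquality
  using (_≡_; _≢_; _≗_; refl; sym; trans; cong; cong₂; subst; subst₂; setoid; ≢-sym)
open import Relation.Nullary using (Dec; yes; no; contradiction)
open import Relation.Nullary.Decidable using (¬?; _×-dec_)
open import Defs

-- Counting with duplicate-free lists

lookup-injective : ∀ {A : Set} {xs : List A} → Unique xs →
  ∀ i j → lookup xs i ≡ lookup xs j → i ≡ j
lookup-injective (_ ∷ _)  zero    zero    _  = refl
lookup-injective (x∉ ∷ _) zero    (suc j) eq = contradiction eq (All.lookup x∉ (∈-lookup j))
lookup-injective (x∉ ∷ _) (suc i) zero    eq = contradiction (sym eq) (All.lookup x∉ (∈-lookup i))
lookup-injective (_ ∷ u)  (suc i) (suc j) eq = cong suc (lookup-injective u i j eq)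

length-injection : ∀ {A B : Set} {xs : List A} {ys : List B} (f : A → B) →
  (∀ x y → f x ≡ f y → x ≡ y) → Unique xs → (∀ {x} → x ∈ xs → f x ∈ ys) →
  length xs ≤ length ys
length-injection {xs = xs} f inj uniq f∈ = injective⇒≤ {f = λ i → index (f∈ (∈-lookup {xs = xs} i))}
  λ {i} {j} eq → lookup-injective uniq i j (inj _ _
    (index-injective (setoid _) (f∈ (∈-lookup i)) (f∈ (∈-lookup j)) eq))

-- Gives a unique candidate, if any, in the list form in which `FewRed` asks for red neighbours.
atMostOne : ∀ {n} {P : Fin n → Set} → (∀ x → Dec (P x)) → (∀ {x y} → P x → P y → x ≡ y) →
  ∃ λ (xs : List (Fin n)) → length xs ≤ 1 × (∀ {x} → P x → x ∈ xs)
atMostOne P? unique with any? P?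
... | yes (x , px) = x ∷ [] , s≤s z≤n , λ py → here (unique py px)
... | no ¬p        = [] , z≤n , λ {x} px → ⊥-elim (¬p (x , px))

bounded : ∀ {n} (f : Fin n → ℕ) → ∃ λ b → ∀ x → f x ≤ b
bounded {zero}  f = 0 , λ ()
bounded {suc n} f with bounded (f ∘ suc)
... | b , f≤b = f zero + b , λ { zero → ℕ.m≤m+n _ b ; (suc x) → ℕ.≤-trans (f≤b x) (ℕ.m≤n+m b _) }

-- Partitions and contraction sequences

-- A map π on the vertices of a graph G stands for the partition into its fibres, and a
-- contraction sequence for a sequence of ever coarser maps.
module Quotients {N d : ℕ} (G : Trigraph N) {A : Set} (_≟ᴬ_ : DecidableEquality A) where

  Seen : (Fin N → A) → Fin N → Fin N → Status → Set
  Seen π x y s = ∃₂ λ x′ y′ → π x′ ≡ π x × π y′ ≡ π y × status G x′ y′ ≡ s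

  -- A red edge certifies that its two fibres are joined by both kinds of pairs; a black edge or
  -- nonedge promises just one such pair. This survives merging: a black and a nonedge witness
  -- together certify the new red edge.
  Witnessed : (Fin N → A) → Fin N → Fin N → Status → Set
  Witnessed π x y red = Seen π x y black × Seen π x y nonedge
  Witnessed π x y s   = Seen π x y s

  record Realised {n} (G′ : Trigraph n) (π : Fin N → A) : Set where
    field
      rep       : Fin n → Fin N
      injective : ∀ i j → π (rep i) ≡ π (rep j) → i ≡ j
      witness   : ∀ i j → i ≢ j → Witnessed π (rep i) (rep j) (status G′ i j)

  open Realised

  -- All realisations are taken at once, so that the renumbering of vertices in a contraction never
  -- has to be tracked.
  Reducible : (Fin N → A) → Set
  Reducible π = ∀ {n} (G′ : Trigraph (suc n)) → Realised G′ π → DSequence d G′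

  Coarser : (π π′ : Fin N → A) → Set
  Coarser π π′ = ∀ x y → π x ≡ π y → π′ x ≡ π′ y

  -- The values a and b are identified, unless one of them is not taken.
  Redirects : (π π′ : Fin N → A) (a b : A) → Set
  Redirects π π′ a b = ∀ x → (π x ≡ a × π′ x ≡ b) ⊎ (π x ≢ a × π′ x ≡ π x)

  FewRed : (Fin N → A) → Set
  FewRed π = ∀ x → ∃ λ (as : List A) → length as ≤ d ×
    (∀ y → π x ≢ π y → Seen π x y black → Seen π x y nonedge → π y ∈ as)

  seen-sym : ∀ {π x y s} → Seen π x y s → Seen π y x s
  seen-sym (x′ , y′ , p , q , r) = y′ , x′ , q , p , trans (status-sym G y′ x′) r

  seen-coarser : ∀ {π π′ x y u v s} → Coarser π π′ → π′ x ≡ π′ u → π′ y ≡ π′ v →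
    Seen π x y s → Seen π′ u v s
  seen-coarser c p q (x′ , y′ , e , f , r) =
    x′ , y′ , trans (c _ _ e) p , trans (c _ _ f) q , r

  witnessed-coarser : ∀ {π π′ x y u v} s → Coarser π π′ → π′ x ≡ π′ u → π′ y ≡ π′ v →
    Witnessed π x y s → Witnessed π′ u v s
  witnessed-coarser nonedge c p q w       = seen-coarser c p q w
  witnessed-coarser black   c p q w       = seen-coarser c p q w
  witnessed-coarser red     c p q (w , z) = seen-coarser c p q w , seen-coarser c p q z

  witnessed-sym : ∀ {π x y} s → Witnessed π x y s → Witnessed π y x s
  witnessed-sym nonedge w       = seen-sym w
  witnessed-sym black   w       = seen-sym w
  witnessed-sym red     (w , z) = seen-sym w , seen-sym z

  witnessed-merge : ∀ {π x y} s t → Witnessed π x y s → Witnessed π x y t →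
    Witnessed π x y (merge s t)
  witnessed-merge black   black   w       _       = w
  witnessed-merge nonedge nonedge w       _       = w
  witnessed-merge black   nonedge w       z       = w , z
  witnessed-merge nonedge black   w       z       = z , w
  witnessed-merge black   red     _       w       = w
  witnessed-merge nonedge red     _       w       = w
  witnessed-merge red     _       w       _       = w

  realised-coarser : ∀ {n π π′} {G′ : Trigraph n} → Coarser π π′ → (r : Realised G′ π) →
    (∀ i j → π′ (rep r i) ≡ π′ (rep r j) → i ≡ j) → Realised G′ π′
  realised-coarser {G′ = G′} c r inj = record
    { rep       = rep r
    ; injective = inj
    ; witness   = λ i j i≢j → witnessed-coarser (status G′ i j) c refl refl (witness r i j i≢j)
    }

  redirects⇒coarser : ∀ {π π′ a b} → Redirects π π′ a b → Coarser π π′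
  redirects⇒coarser f x y eq with f x | f y
  ... | inj₁ (_ , p) | inj₁ (_ , q) = trans p (sym q)
  ... | inj₁ (p , _) | inj₂ (q , _) = contradiction (trans (sym eq) p) q
  ... | inj₂ (p , _) | inj₁ (q , _) = contradiction (trans eq q) p
  ... | inj₂ (_ , p) | inj₂ (_ , q) = trans p (trans eq (sym q))

  redirects⇒one-pair : ∀ {π π′ a b} → Redirects π π′ a b → ∀ x y → π′ x ≡ π′ y →
    π x ≡ π y ⊎ (π x ≡ a × π y ≡ b) ⊎ (π x ≡ b × π y ≡ a)
  redirects⇒one-pair f x y eq with f x | f y
  ... | inj₁ (p , _) | inj₁ (q , _) = inj₁ (trans p (sym q))
  ... | inj₁ (p , p′) | inj₂ (_ , q) = inj₂ (inj₁ (p , trans (sym q) (trans (sym eq) p′)))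
  ... | inj₂ (_ , p) | inj₁ (q , q′) = inj₂ (inj₂ (trans (sym p) (trans eq q′) , q))
  ... | inj₂ (_ , p) | inj₂ (_ , q) = inj₁ (trans (sym p) (trans eq q))

  maxRedDegree : ∀ {n π} {G′ : Trigraph n} → FewRed π → Realised G′ π → MaxRedDegree≤ d G′
  maxRedDegree {n} {π} {G′} few r u with few (rep r u)
  ... | as , as≤d , covers = ℕ.≤-trans
    (length-injection (π ∘ rep r) (injective r) (Unique.filter⁺ isRed (Unique.tabulate⁺ id))
      λ v∈ → red⇒∈ _ (proj₂ (∈-filter⁻ isRed {xs = allFin n} v∈)))
    as≤d
    where
    isRed : ∀ v → Dec (status G′ u v ≡ red)
    isRed v = red? (status G′ u v)
    red⇒≢ : ∀ v → status G′ u v ≡ red → u ≢ v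
    red⇒≢ _ isR refl with () ← trans (sym isR) (loopless G′ u)
    red⇒∈ : ∀ v → status G′ u v ≡ red → π (rep r v) ∈ as
    -- A red status carries exactly the two witnesses that `FewRed` asks for.
    red⇒∈ v isR = let b , n = subst (Witnessed π _ _) isR (witness r u v (red⇒≢ v isR)) in
      covers (rep r v) (red⇒≢ v isR ∘ injective r u v) b n

  contract-realised : ∀ {n π π′ a b} {G′ : Trigraph (suc n)} → Redirects π π′ a b →
    (r : Realised G′ π) (u v : Fin (suc n)) → u ≢ v → π′ (rep r u) ≡ π′ (rep r v) →
    Realised (contract G′ u v) π′
  contract-realised {n} {π} {π′} {G′ = G′} f r u v u≢v π′u≡π′v = record
    { rep       = rep r ∘ punchIn v
    ; injective = λ i j eq → punchIn-injective v i j
                    (injective-away _ _ (punchInᵢ≢i v i) (punchInᵢ≢i v j) eq)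
    ; witness   = λ i j i≢j → merged _ _ (punchInᵢ≢i v i) (punchInᵢ≢i v j)
                    (i≢j ∘ punchIn-injective v i j)
    }
    where
    π-injective = injective r
    injective-away : ∀ i j → i ≢ v → j ≢ v → π′ (rep r i) ≡ π′ (rep r j) → i ≡ j
    injective-away i j i≢v j≢v eq
      with redirects⇒one-pair f _ _ eq | redirects⇒one-pair f _ _ π′u≡π′v
    ... | inj₁ e | _ = π-injective i j e
    ... | _ | inj₁ e = contradiction (π-injective u v e) u≢v
    -- Both collisions are between the values `a` and `b`, so `i` or `j` would share its fibre with
    -- the deleted vertex `v`.
    ... | inj₂ (inj₁ (p , q)) | inj₂ (inj₁ (p′ , q′)) =
      contradiction (π-injective j v (trans q (sym q′))) j≢v
    ... | inj₂ (inj₁ (p , q)) | inj₂ (inj₂ (p′ , q′)) =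
      contradiction (π-injective i v (trans p (sym q′))) i≢v
    ... | inj₂ (inj₂ (p , q)) | inj₂ (inj₁ (p′ , q′)) =
      contradiction (π-injective i v (trans p (sym q′))) i≢v
    ... | inj₂ (inj₂ (p , q)) | inj₂ (inj₂ (p′ , q′)) =
      contradiction (π-injective j v (trans q (sym q′))) j≢v

    coarser = redirects⇒coarser f
    through-both : ∀ y → u ≢ y → v ≢ y →
      Witnessed π′ (rep r u) (rep r y) (merge (status G′ u y) (status G′ v y))
    through-both y u≢y v≢y = witnessed-merge (status G′ u y) (status G′ v y)
      (witnessed-coarser (status G′ u y) coarser refl refl (witness r u y u≢y))
      (witnessed-coarser (status G′ v y) coarser (sym π′u≡π′v) refl (witness r v y v≢y))

    merged : ∀ x y → x ≢ v → y ≢ v → x ≢ y →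
      Witnessed π′ (rep r x) (rep r y) (mergedStatus G′ u v x y)
    merged x y x≢v y≢v x≢y with x ≟ u | y ≟ u
    ... | yes refl | yes refl = contradiction refl x≢y
    ... | yes refl | no y≢u   = through-both y x≢y (≢-sym y≢v)
    ... | no x≢u   | yes refl = witnessed-sym (merge (status G′ u x) (status G′ v x))
                                  (through-both x (≢-sym x≢u) (≢-sym x≢v))
    ... | no _     | no _     = witnessed-coarser (status G′ x y) coarser refl refl (witness r x y x≢y)

  -- If two representatives collide under `π′`, contracting them is the next step; otherwise the
  -- same trigraph already realises `π′` and no contraction is spent.
  reducible-advance : ∀ {π π′ a b} → FewRed π → Redirects π π′ a b → Reducible π′ → Reducible π
  reducible-advance {π} {π′} few f reducible {n} G′ r = by-collision
    (any? (λ i → any? (λ j → ¬? (i ≟ j) ×-dec (π′ (rep r i) ≟ᴬ π′ (rep r j)))))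
    where
    contracted : ∀ {n} (G′ : Trigraph (suc n)) (r : Realised G′ π) (i j : Fin (suc n)) →
      i ≢ j → π′ (rep r i) ≡ π′ (rep r j) → DSequence d G′
    contracted {zero}  G′ r zero zero i≢j _ = contradiction refl i≢j
    contracted {suc n} G′ r i j i≢j eq = step (maxRedDegree few r) i j i≢j
      (reducible (contract G′ i j) (contract-realised f r i j i≢j eq))

    by-collision : Dec (∃ λ i → ∃ λ j → i ≢ j × π′ (rep r i) ≡ π′ (rep r j)) → DSequence d G′
    by-collision (yes (i , j , i≢j , eq)) = contracted G′ r i j i≢j eq
    by-collision (no distinct) =
      reducible G′ (realised-coarser (redirects⇒coarser f) r injective′)
      where
      injective′ : ∀ i j → π′ (rep r i) ≡ π′ (rep r j) → i ≡ j
      injective′ i j eq with i ≟ j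
      ... | yes i≡j = i≡j
      ... | no i≢j  = ⊥-elim (distinct (i , j , i≢j , eq))

  reducible-cong : ∀ {π π′} → π ≗ π′ → Reducible π′ → Reducible π
  reducible-cong e red′ G′ r = red′ G′ (realised-coarser
    (λ x y p → trans (sym (e x)) (trans p (e y))) r
    (λ i j p → injective r i j (trans (e _) (trans p (sym (e _))))))

  reducible-constant : ∀ {π} → (∀ x y → π x ≡ π y) → Reducible π
  reducible-constant const {suc n} G′ r with () ← injective r zero (suc zero) (const _ _)
  reducible-constant const {zero}  G′ r = end (maxRedDegree few r)
    where
    few : FewRed _
    few x = [] , z≤n , λ y x≢y → contradiction (const x y) x≢y

-- Walks in the binary heap

ancestor : ℕ → ℕ → ℕ
ancestor zero    x = x
ancestor (suc a) x = ⌊ ancestor a x /2⌋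

-- Equal or adjacent in the binary heap, where the parent of x is ⌊ x /2⌋ (so 0 is above the root 1).
Near : ℕ → ℕ → Set
Near x y = x ≡ y ⊎ ⌊ x /2⌋ ≡ y ⊎ x ≡ ⌊ y /2⌋

near-sym : ∀ {x y} → Near x y → Near y x
near-sym (inj₁ e)        = inj₁ (sym e)
near-sym (inj₂ (inj₁ e)) = inj₂ (inj₂ (sym e))
near-sym (inj₂ (inj₂ e)) = inj₂ (inj₁ (sym e))

n≡2⌊n/2⌋or1+2⌊n/2⌋ : ∀ n → n ≡ ⌊ n /2⌋ + ⌊ n /2⌋ ⊎ n ≡ suc (⌊ n /2⌋ + ⌊ n /2⌋)
n≡2⌊n/2⌋or1+2⌊n/2⌋ zero = inj₁ refl
n≡2⌊n/2⌋or1+2⌊n/2⌋ (suc zero) = inj₂ refl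
n≡2⌊n/2⌋or1+2⌊n/2⌋ (suc (suc n)) rewrite ℕ.+-suc ⌊ n /2⌋ ⌊ n /2⌋
  with n≡2⌊n/2⌋or1+2⌊n/2⌋ n
... | inj₁ e = inj₁ (cong (λ k → suc (suc k)) e)
... | inj₂ e = inj₂ (cong (λ k → suc (suc k)) e)

⌊n/2⌋<m : ∀ {n m} → n < m + m → ⌊ n /2⌋ < m
⌊n/2⌋<m {n} {m} n<m+m = ℕ.≰⇒> λ m≤ → ℕ.<⇒≱ n<m+m (ℕ.≤-trans
  (ℕ.+-mono-≤ m≤ (ℕ.≤-trans m≤ (ℕ.⌊n/2⌋≤⌈n/2⌉ n))) (ℕ.≤-reflexive (ℕ.⌊n/2⌋+⌈n/2⌉≡n n)))

m≤⌊n/2⌋ : ∀ {m n} → m + m ≤ n → m ≤ ⌊ n /2⌋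
m≤⌊n/2⌋ {m} m+m≤n = ℕ.≤-trans (ℕ.≤-reflexive (ℕ.n≡⌊n+n/2⌋ m)) (ℕ.⌊n/2⌋-mono m+m≤n)

heapNeighbours : ℕ → List ℕ
heapNeighbours x = ⌊ x /2⌋ ∷ x + x ∷ suc (x + x) ∷ []

near⇒∈ : ∀ {x y} → Near x y → x ≢ y → y ∈ heapNeighbours x
near⇒∈ (inj₁ e) x≢y = contradiction e x≢y
near⇒∈ (inj₂ (inj₁ e)) _ = here (sym e)
near⇒∈ {y = y} (inj₂ (inj₂ refl)) _ with n≡2⌊n/2⌋or1+2⌊n/2⌋ y
... | inj₁ e = there (here e)
... | inj₂ e = there (there (here e))

-- Level `d` of the heap, whose root 1 has level 0.
AtDepth : ℕ → ℕ → Set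
AtDepth d x = 2 ^ d ≤ x × x < 2 ^ suc d

2^-double : ∀ d → 2 ^ d + 2 ^ d ≡ 2 ^ suc d
2^-double d = cong (2 ^ d +_) (sym (ℕ.+-identityʳ _))

ancestor-depth : ∀ d a {x} → AtDepth (a + d) x → AtDepth d (ancestor a x)
ancestor-depth d zero    p = p
ancestor-depth d (suc a) {x} p
  with ancestor-depth (suc d) a (subst (λ e → AtDepth e x) (sym (ℕ.+-suc a d)) p)
... | l , u = m≤⌊n/2⌋ (ℕ.≤-trans (ℕ.≤-reflexive (2^-double d)) l)
            , ⌊n/2⌋<m (ℕ.<-≤-trans u (ℕ.≤-reflexive (sym (2^-double (suc d)))))

-- After `d` halvings both nodes have reached the root 1, and from then on their ancestors coincide.
ancestors-meet : ∀ {d x y} → AtDepth d x → AtDepth d y → ∀ {a} → d ≤ a → ancestor a x ≡ ancestor a y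
ancestors-meet {d} {x} {y} dx dy = λ d≤a → above (ℕ.≤⇒≤′ d≤a)
  where
  root : ∀ {x} → AtDepth d x → ancestor d x ≡ 1
  root {x} p with ancestor-depth 0 d (subst (λ e → AtDepth e x) (sym (ℕ.+-identityʳ d)) p)
  ... | l , s≤s u = ℕ.≤-antisym u l
  above : ∀ {a} → d ≤′ a → ancestor a x ≡ ancestor a y
  above ≤′-refl = trans (root dx) (sym (root dy))
  above (≤′-step p) = cong ⌊_/2⌋ (above p)

ancestor-≤ : ∀ a {x} → ancestor a x ≤ x
ancestor-≤ zero    = ℕ.≤-refl
ancestor-≤ (suc a) = ℕ.≤-trans (ℕ.⌊n/2⌋≤n _) (ancestor-≤ a)

-- The last halving acts on a number at most `x`, hence below 2^(d+1). This keeps inner vertices off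
-- the leaves.
proper-ancestor-< : ∀ {d x} a → AtDepth d x → ancestor (suc a) x < 2 ^ d
proper-ancestor-< {d} a (_ , u) =
  ⌊n/2⌋<m (ℕ.≤-<-trans (ancestor-≤ a) (ℕ.<-≤-trans u (ℕ.≤-reflexive (sym (2^-double d)))))

-- The vertex at distance a from u and b from v on a subdivided edge is sent towards the
-- root from the nearer of its two ends.
walk : (u v a b : ℕ) → ℕ
walk u v a b = if a ≤ᵇ b then ancestor a u else ancestor b v

walk-≤ : ∀ {u v a b} → a ≤ b → walk u v a b ≡ ancestor a u
walk-≤ {a = a} {b} a≤b with a ≤ᵇ b | ℕ.≤⇒≤ᵇ a≤b
... | true | _ = refl

walk-> : ∀ {u v a b} → b < a → walk u v a b ≡ ancestor b v
walk-> {a = a} {b} b<a with a ≤ᵇ b in eq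
... | false = refl
... | true  = contradiction (ℕ.≤ᵇ⇒≤ a b (subst T (sym eq) _)) (ℕ.<⇒≱ b<a)

-- Away from the middle a step goes to a parent or to a child; at the middle the walk changes sides,
-- where `long` makes the two branches meet.
walk-near : ∀ {d u v} → AtDepth d u → AtDepth d v → ∀ a b → d + d ≤ a + suc b →
  Near (walk u v a (suc b)) (walk u v (suc a) b)
walk-near {d} {u} {v} du dv a b long with ℕ.<-cmp a b
... | tri< a<b _ _
  rewrite walk-≤ {u} {v} (ℕ.m≤n⇒m≤1+n (ℕ.<⇒≤ a<b)) | walk-≤ {u} {v} a<b = inj₂ (inj₁ refl)
-- Odd length 2a+1: from 2d ≤ 2a+1 follows d ≤ a, so the change of sides stays on one node.
... | tri≈ _ refl _
  rewrite walk-≤ {u} {v} (ℕ.n≤1+n a) | walk-> {u} {v} (ℕ.n<1+n a)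
  = inj₁ (ancestors-meet {d} du dv (ℕ.≮⇒≥ λ a<d → ℕ.<⇒≱ (ℕ.+-mono-<-≤ a<d a<d) long))
... | tri> _ _ b<a with ℕ.m≤n⇒m<n∨m≡n b<a
... | inj₁ 1+b<a
  rewrite walk-> {u} {v} 1+b<a | walk-> {u} {v} (ℕ.m≤n⇒m≤1+n b<a) = inj₂ (inj₂ refl)
-- Even length 2(b+1): d ≤ b+1, so the last node on the side of `u` is also the parent of the next
-- node on the side of `v`.
... | inj₂ refl
  rewrite walk-≤ {u} {v} (ℕ.≤-refl {suc b}) | walk-> {u} {v} (ℕ.m≤n⇒m≤1+n (ℕ.n<1+n b))
  = inj₂ (inj₂ (ancestors-meet {d} du dv (ℕ.≮⇒≥ λ a<d → ℕ.<⇒≱ (ℕ.+-mono-<-≤ a<d (ℕ.<⇒≤ a<d)) long)))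

-- Folding a graph onto the heap

-- Rank 0 marks the vertices on the tree from the start; the others are folded in order of rank. By
-- `consecutive`, an edge between two of the latter joins successive ranks.
module Folding {m : ℕ} (G : Trigraph (suc m)) (place rank : Fin (suc m) → ℕ)
  (isGraph : IsGraph G)
  (near : ∀ x y → status G x y ≡ black → Near (place x) (place y))
  (rank-injective : ∀ {x y} → rank x ≢ 0 → rank x ≡ rank y → x ≡ y)
  (place-injective : ∀ {x y} → rank x ≡ 0 → place x ≡ place y → x ≡ y)
  (consecutive : ∀ {x y} → status G x y ≡ black → rank x ≢ 0 → rank x < rank y → rank y ≡ suc (rank x))
  where

  -- `inj₁` holds heap nodes, `inj₂` vertices not yet folded.
  Node : Set
  Node = ℕ ⊎ Fin (suc m)

  open Quotients {d = 4} G (≡-dec ℕ._≟_ (_≟_ {suc m}))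

  lower : ℕ → ℕ → ℕ
  lower j t with t ℕ.≟ suc j
  ... | yes _ = ⌊ suc j /2⌋
  ... | no  _ = t

  lower-≤ : ∀ {j t} → t ≤ suc j → lower j t ≤ j
  lower-≤ {j} {t} t≤ with t ℕ.≟ suc j
  ... | yes _  = ℕ.≤-pred (ℕ.⌊n/2⌋<n j)
  ... | no t≢ = ℕ.≤-pred (ℕ.≤∧≢⇒< t≤ t≢)

  -- Children have larger indices, so the parent is the only neighbour below `suc j`.
  near-top : ∀ {j t} → t < suc j → Near (suc j) t → ⌊ suc j /2⌋ ≡ t
  near-top t< (inj₁ refl)        = contradiction t< (ℕ.<-irrefl refl)
  near-top t< (inj₂ (inj₁ e))    = e
  near-top {j} {t} t< (inj₂ (inj₂ e)) =
    contradiction (ℕ.≤-<-trans (ℕ.≤-trans (ℕ.≤-reflexive e) (ℕ.⌊n/2⌋≤n t)) t<) (ℕ.<-irrefl refl)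

  lower-near : ∀ {j t s} → t ≤ suc j → s ≤ suc j → Near t s → Near (lower j t) (lower j s)
  lower-near {j} {t} {s} t≤ s≤ ts with t ℕ.≟ suc j | s ℕ.≟ suc j
  ... | yes _    | yes _    = inj₁ refl
  ... | yes refl | no s≢    = inj₁ (near-top (ℕ.≤∧≢⇒< s≤ s≢) ts)
  ... | no t≢    | yes refl = inj₁ (sym (near-top (ℕ.≤∧≢⇒< t≤ t≢) (near-sym ts)))
  ... | no _     | no _     = ts

  lower-redirects : ∀ j (p : Fin (suc m) → ℕ) →
    Redirects (inj₁ ∘ p) (inj₁ ∘ lower j ∘ p) (inj₁ (suc j)) (inj₁ ⌊ suc j /2⌋)
  lower-redirects j p x with p x ℕ.≟ suc j
  ... | yes e = inj₁ (cong inj₁ e , refl)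
  ... | no ≢  = inj₂ (≢ ∘ inj₁-injective , refl)

  -- Nodes go in decreasing order of index, so each is a leaf of the remaining tree when it is
  -- contracted into its parent.
  collapse : ∀ j (p : Fin (suc m) → ℕ) → (∀ x → p x ≤ j) →
    (∀ x y → status G x y ≡ black → Near (p x) (p y)) → Reducible (inj₁ ∘ p)
  -- Even the root 1 has been sent on to 0, so the map is constant.
  collapse zero p p≤ p-near = reducible-constant λ x y →
    cong inj₁ (trans (ℕ.n≤0⇒n≡0 (p≤ x)) (sym (ℕ.n≤0⇒n≡0 (p≤ y))))
  collapse (suc j) p p≤ p-near = reducible-advance few (lower-redirects j p)
    (collapse j (lower j ∘ p) (λ x → lower-≤ (p≤ x))
      λ x y xy → lower-near (p≤ x) (p≤ y) (p-near x y xy))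
    where
    few : FewRed (inj₁ ∘ p)
    few x = map inj₁ (heapNeighbours (p x)) , ℕ.n≤1+n 3 , λ { y x≢y (x′ , y′ , e , f , b) _ →
      ∈-map⁺ inj₁ (near⇒∈ (subst₂ Near (inj₁-injective e) (inj₁-injective f) (p-near x′ y′ b))
                          (x≢y ∘ cong inj₁)) }

  -- Folding vertex by vertex

  fold : ℕ → Fin (suc m) → Node
  fold k x with rank x ≤? k
  ... | yes _ = inj₁ (place x)
  ... | no  _ = inj₂ x

  fold-low : ∀ {k x} → rank x ≤ k → fold k x ≡ inj₁ (place x)
  fold-low {k} {x} low with rank x ≤? k
  ... | yes _ = refl
  ... | no ¬low = contradiction low ¬low

  fold-high : ∀ {k x} → k < rank x → fold k x ≡ inj₂ x
  fold-high {k} {x} high with rank x ≤? k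
  ... | yes low = contradiction high (ℕ.≤⇒≯ low)
  ... | no _ = refl

  fold≡inj₁ : ∀ {k x t} → fold k x ≡ inj₁ t → rank x ≤ k × place x ≡ t
  fold≡inj₁ {k} {x} eq with rank x ≤? k
  fold≡inj₁ refl | yes low = low , refl

  fold≡inj₂ : ∀ {k x y} → fold k x ≡ inj₂ y → k < rank x × x ≡ y
  fold≡inj₂ {k} {x} eq with rank x ≤? k
  fold≡inj₂ refl | no ¬low = ℕ.≰⇒> ¬low , refl

  fold-unchanged : ∀ {k x} → rank x ≢ suc k → fold (suc k) x ≡ fold k x
  fold-unchanged {k} {x} ≢ with ℕ.≤-total (rank x) k
  ... | inj₁ low = trans (fold-low (ℕ.m≤n⇒m≤1+n low)) (sym (fold-low low))
  ... | inj₂ k≤ with ℕ.m≤n⇒m<n∨m≡n k≤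
  ... | inj₂ refl = trans (fold-low (ℕ.n≤1+n _)) (sym (fold-low ℕ.≤-refl))
  ... | inj₁ high = trans (fold-high (ℕ.≤∧≢⇒< high (≢-sym ≢))) (sym (fold-high high))

  fold-redirects : ∀ {k x} → rank x ≡ suc k →
    Redirects (fold k) (fold (suc k)) (inj₂ x) (inj₁ (place x))
  fold-redirects {k} {x} rank≡ y with y ≟ x
  ... | yes refl = inj₁ (fold-high (ℕ.≤-reflexive (sym rank≡)) , fold-low (ℕ.≤-reflexive rank≡))
  ... | no y≢x   = inj₂ ((λ e → y≢x (proj₂ (fold≡inj₂ e))) , fold-unchanged λ e →
    y≢x (sym (rank-injective (λ z → ℕ.0≢1+n (trans (sym z) rank≡)) (trans rank≡ (sym e)))))

  -- A red edge between the tree and the rest can only come from the last folded vertex.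
  crossing : ∀ {k x y t z} → fold k x ≡ inj₁ t → fold k y ≡ inj₂ z →
    Seen (fold k) x y black → Seen (fold k) x y nonedge →
    rank z ≡ suc k × ∃ λ w → (rank w ≢ 0 × rank w ≡ k) × place w ≡ t
  crossing {k} ex ey (x₁ , y₁ , e₁ , f₁ , b) (x₂ , y₂ , e₂ , f₂ , n)
    with fold≡inj₁ (trans e₁ ex) | fold≡inj₁ {k} {x₂} (trans e₂ ex)
       | fold≡inj₂ (trans f₁ ey) | fold≡inj₂ {k} {y₂} (trans f₂ ey)
  ... | low , refl | _ , place≡ | high , refl | _ , refl with rank x₁ ℕ.≟ 0
  -- A rank 0 vertex is alone on its node and `z` is alone in its fibre, so the black pair and the
  -- nonedge would be the same pair.
  ... | yes rank≡0 with refl ← place-injective rank≡0 (sym place≡) with () ← trans (sym b) n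
  ... | no inside = trans z-next (cong suc rank≡k) , x₁ , (inside , rank≡k) , refl
    where
    z-next = consecutive b inside (ℕ.≤-<-trans low high)
    -- The ranks of `x₁` and `z` are successive and lie on either side of the threshold `k`.
    rank≡k = ℕ.≤-antisym low (ℕ.≤-pred (subst (k <_) z-next high))

  -- A tree node sees at most three heap neighbours and the next vertex to fold, `frontier`; an
  -- unfolded vertex sees at most the node that received `latest`.
  few-red : ∀ k → FewRed (fold k)
  few-red k x = by-image (fold k x) refl
    where
    frontier = atMostOne {P = λ y → rank y ≡ suc k} (λ y → rank y ℕ.≟ suc k)
      λ p q → rank-injective (λ z → ℕ.0≢1+n (trans (sym z) p)) (trans p (sym q))
    latest = atMostOne {P = λ y → rank y ≢ 0 × rank y ≡ k}
      (λ y → ¬? (rank y ℕ.≟ 0) ×-dec (rank y ℕ.≟ k))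
      λ { (p , p′) (_ , q) → rank-injective p (trans p′ (sym q)) }

    by-image : ∀ a → fold k x ≡ a → ∃ λ (as : List Node) → length as ≤ 4 ×
      (∀ y → fold k x ≢ fold k y → Seen (fold k) x y black →
        Seen (fold k) x y nonedge → fold k y ∈ as)
    by-image (inj₁ t) ex =
      map inj₁ (heapNeighbours t) ++ map inj₂ (proj₁ frontier) ,
      ℕ.+-monoʳ-≤ 3 (ℕ.≤-trans (ℕ.≤-reflexive (length-map inj₂ (proj₁ frontier)))
                                 (proj₁ (proj₂ frontier))) ,
      λ y x≢y b n → covers y x≢y b n (fold k y) refl
      where
      covers : ∀ y → fold k x ≢ fold k y → Seen (fold k) x y black → Seen (fold k) x y nonedge →
        ∀ c → fold k y ≡ c → fold k y ∈ map inj₁ (heapNeighbours t) ++ map inj₂ (proj₁ frontier)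
      covers y x≢y (x′ , y′ , e , f , b) _ (inj₁ s) ey rewrite ey =
        ∈-++⁺ˡ (∈-map⁺ inj₁ (near⇒∈
          (subst₂ Near (proj₂ (fold≡inj₁ (trans e ex))) (proj₂ (fold≡inj₁ {k} {y′} f)) (near x′ y′ b))
          λ t≡s → x≢y (trans ex (cong inj₁ t≡s))))
      covers y _ b n (inj₂ z) ey = subst (_∈ _) (sym ey)
        (∈-++⁺ʳ (map inj₁ (heapNeighbours t)) (∈-map⁺ inj₂
          (proj₂ (proj₂ frontier) (proj₁ (crossing {k} {x} {y} ex ey b n)))))
    by-image (inj₂ z) ex =
      map (inj₁ ∘ place) (proj₁ latest) ,
      ℕ.≤-trans (ℕ.≤-reflexive (length-map _ (proj₁ latest)))
              (ℕ.≤-trans (proj₁ (proj₂ latest)) (s≤s z≤n)) ,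
      λ y x≢y b n → covers y x≢y b n (fold k y) refl
      where
      covers : ∀ y → fold k x ≢ fold k y → Seen (fold k) x y black → Seen (fold k) x y nonedge →
        ∀ c → fold k y ≡ c → fold k y ∈ map (inj₁ ∘ place) (proj₁ latest)
      covers y _ b n (inj₁ t) ey
        with crossing {k} {y} {x} ey ex (seen-sym {fold k} {x} {y} b) (seen-sym {fold k} {x} {y} n)
      ... | _ , w , w-latest , refl = subst (_∈ _) (sym ey) (∈-map⁺ _ (proj₂ (proj₂ latest) w-latest))
      covers y x≢y (x₁ , y₁ , e₁ , f₁ , b) (x₂ , y₂ , e₂ , f₂ , n) (inj₂ w) ey
        with fold≡inj₂ {k} {x₁} (trans e₁ ex) | fold≡inj₂ {k} {x₂} (trans e₂ ex)
           | fold≡inj₂ {k} {y₁} (trans f₁ ey) | fold≡inj₂ {k} {y₂} (trans f₂ ey)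
      -- Two unfolded vertices are singleton fibres, and one pair has one status.
      ... | _ , refl | _ , refl | _ , refl | _ , refl with () ← trans (sym b) n

  -- `r` bounds the number of remaining stages. Ranks may have gaps; a stage whose rank no vertex
  -- has changes nothing.
  fold-reducible : ∀ r k → (∀ x → rank x ≤ r + k) → Reducible (fold k)
  fold-reducible zero k rank≤ = reducible-cong (λ x → fold-low (rank≤ x))
    (collapse (proj₁ (bounded place)) place (proj₂ (bounded place)) near)
  fold-reducible (suc r) k rank≤ with any? (λ x → rank x ℕ.≟ suc k)
                                    | fold-reducible r (suc k) (λ x →
                                        subst (rank x ≤_) (sym (ℕ.+-suc r k)) (rank≤ x))
  ... | yes (x , rank≡) | reducible = reducible-advance (few-red k) (fold-redirects rank≡) reducible
  ... | no none         | reducible = reducible-cong (λ x → sym (fold-unchanged λ e → none (x , e))) reducible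

  -- Stage 0 has singleton fibres, because rank 0 vertices have distinct places.
  realised : Realised G (fold 0)
  realised = record
    { rep       = id
    ; injective = λ i j eq → injective i j (fold 0 j) refl eq
    ; witness   = λ i j _ → witness i j (status G i j) refl
    }
    where
    injective : ∀ i j c → fold 0 j ≡ c → fold 0 i ≡ fold 0 j → i ≡ j
    injective i j (inj₁ t) ej eq with fold≡inj₁ (trans eq ej) | fold≡inj₁ {0} {j} ej
    ... | low , refl | _ , place≡ = place-injective (ℕ.n≤0⇒n≡0 low) (sym place≡)
    injective i j (inj₂ z) ej eq = trans (proj₂ (fold≡inj₂ (trans eq ej))) (sym (proj₂ (fold≡inj₂ {0} {j} ej)))
    witness : ∀ i j s → status G i j ≡ s → Witnessed (fold 0) i j s
    witness i j nonedge eq = i , j , refl , refl , eq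
    witness i j black   eq = i , j , refl , refl , eq
    witness i j red     eq = contradiction eq (isGraph i j)

  sequence : DSequence 4 G
  sequence = fold-reducible (proj₁ (bounded rank)) 0
    (λ x → ℕ.≤-trans (proj₂ (bounded rank) x) (ℕ.m≤m+n _ 0)) G realised

-- Folding a subdivision

-- For d > 0 minimality gives 2^(d-1) < n, so 2^(2d-2) < n^2 ≤ 2^k and 2d-2 < k. Here `suc k` is the
-- number of edges on a path with `k` inner vertices.
ceilLog : ∀ n → ∃ λ d → n ≤ 2 ^ d × (∀ k → n ^ 2 ≤ 2 ^ k → d + d ≤ suc k)
ceilLog n with least (λ d → n ≤? 2 ^ d) n (ℕ.<⇒≤ (n<2^n n))
  where
  n<2^n : ∀ n → n < 2 ^ n
  n<2^n zero    = s≤s z≤n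
  n<2^n (suc n) = ℕ.≤-trans (ℕ.+-mono-≤ (ℕ.m^n>0 2 n) (n<2^n n)) (ℕ.≤-reflexive (2^-double n))
... | zero  , n≤ , minimal = zero , n≤ , λ _ _ → z≤n
... | suc d , n≤ , minimal = suc d , n≤ , λ k n²≤ → s≤s (subst (_≤ k) (sym (ℕ.+-suc d d))
  (2^-cancel-< (ℕ.<-≤-trans (ℕ.≤-<-trans (ℕ.≤-reflexive (ℕ.^-distribˡ-+-* 2 d d)) (ℕ.*-mono-< 2^d<n 2^d<n))
    (ℕ.≤-trans (ℕ.≤-reflexive (cong (n *_) (sym (ℕ.*-identityʳ n)))) n²≤))))
  where
  2^d<n : 2 ^ d < n
  2^d<n = ℕ.≰⇒> λ n≤2^d → ℕ.<-irrefl refl (minimal d n≤2^d)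
  2^-cancel-< : ∀ {a b} → 2 ^ a < 2 ^ b → a < b
  2^-cancel-< lt = ℕ.≰⇒> λ b≤a → ℕ.<⇒≱ lt (ℕ.^-monoʳ-≤ 2 b≤a)

module Subdivided {n m : ℕ} (H : Trigraph n) (G : Trigraph (suc m)) (len : Edge H → ℕ)
  (long : ∀ e → n ^ 2 ≤ 2 ^ len e) (subdivision : IsSubdivision H len G) where

  open IsSubdivision subdivision
  open Inverse vertices using (to; from; strictlyInverseˡ; strictlyInverseʳ)

  depth : ℕ
  depth = proj₁ (ceilLog n)

  leaf : Fin n → ℕ
  leaf v = 2 ^ depth + toℕ v

  leaf-depth : ∀ v → AtDepth depth (leaf v)
  leaf-depth v = ℕ.m≤m+n _ _ , ℕ.<-≤-trans
    (ℕ.+-monoʳ-< (2 ^ depth) (ℕ.<-≤-trans (toℕ<n v) (proj₁ (proj₂ (ceilLog n)))))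
    (ℕ.≤-reflexive (2^-double depth))

  -- The path replacing `e` has `suc (len e)` edges, which gives the distance left to `tgt e`.
  position : Edge H → ℕ → ℕ
  position e a = walk (leaf (src e)) (leaf (tgt e)) a (suc (len e) ∸ a)

  place : SubdivisionVertex H len → ℕ
  place (original v) = leaf v
  place (inner e i)  = position e (suc (toℕ i))

  position-near : ∀ e a → a ≤ len e → Near (position e a) (position e (suc a))
  position-near e a a≤ rewrite ℕ.+-∸-assoc 1 a≤ =
    walk-near {depth} (leaf-depth (src e)) (leaf-depth (tgt e)) a (len e ∸ a)
      (ℕ.≤-trans (proj₂ (proj₂ (ceilLog n)) (len e) (long e))
        (ℕ.≤-reflexive (sym (trans (ℕ.+-suc a _) (cong suc (ℕ.m+[n∸m]≡n a≤))))))

  position-end : ∀ e → position e (suc (len e)) ≡ leaf (tgt e)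
  position-end e rewrite ℕ.n∸n≡0 (len e) = refl

  follows-near : ∀ {x y} → Follows H len x y → Near (place x) (place y)
  follows-near (direct e len≡0) =
    -- `position e 0` computes to `leaf (src e)`.
    subst (Near _) (trans (cong (position e ∘ suc) (sym len≡0)) (position-end e)) (position-near e 0 z≤n)
  follows-near (first e i i≡0) =
    subst (Near _) (cong (position e ∘ suc) (sym i≡0)) (position-near e 0 z≤n)
  follows-near (next e i j j≡1+i) =
    subst (Near _) (cong (position e ∘ suc) (sym j≡1+i)) (position-near e (suc (toℕ i)) (toℕ<n i))
  follows-near (last e i 1+i≡len) =
    subst (Near _) (trans (cong (position e ∘ suc) 1+i≡len) (position-end e))
      (position-near e (suc (toℕ i)) (toℕ<n i))

  leaf-injective : ∀ {u v} → leaf u ≡ leaf v → u ≡ v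
  leaf-injective = toℕ-injective ∘ ℕ.+-cancelˡ-≡ (2 ^ depth) _ _

  -- An inner vertex is at least one step from both ends, so it lands on a proper ancestor of a
  -- leaf.
  inner<leaf : ∀ e i v → place (inner e i) < leaf v
  inner<leaf e i v with suc (toℕ i) ≤? len e ∸ toℕ i
  ... | yes near-src rewrite walk-≤ {leaf (src e)} {leaf (tgt e)} near-src =
    ℕ.<-≤-trans (proper-ancestor-< {depth} (toℕ i) (leaf-depth (src e))) (ℕ.m≤m+n _ _)
  ... | no far-src rewrite walk-> {leaf (src e)} {leaf (tgt e)} (ℕ.≰⇒> far-src)
                         | sym (ℕ.suc-pred (len e ∸ toℕ i) {{>-nonZero (ℕ.m<n⇒0<n∸m (toℕ<n i))}}) =
    ℕ.<-≤-trans (proper-ancestor-< {depth} (pred (len e ∸ toℕ i)) (leaf-depth (tgt e))) (ℕ.m≤m+n _ _)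

  len≤ : ∀ e → len e ≤ suc m
  len≤ e = injective⇒≤ {f = to ∘ inner e} λ eq →
    inner-injective (trans (sym (strictlyInverseʳ _)) (trans (cong from eq) (strictlyInverseʳ _)))
    where
    inner-injective : ∀ {i j} → inner {H = H} {len} e i ≡ inner e j → i ≡ j
    inner-injective refl = refl

  -- Lexicographic in source, target and index, so that edges are folded one after another.
  -- `inject≤` gives all edges the common radix `suc m`; the leading `suc` reserves 0 for original
  -- vertices.
  rank : SubdivisionVertex H len → ℕ
  rank (original _) = 0
  rank (inner e i)  = suc (toℕ (combine (combine (src e) (tgt e)) (inject≤ i (len≤ e))))

  inner-≡ : ∀ {e e′ i j} → src e ≡ src e′ → tgt e ≡ tgt e′ → toℕ i ≡ toℕ j →
    inner {H = H} {len} e i ≡ inner e′ j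
  inner-≡ {edge _ _ _ _} {edge _ _ _ _} refl refl eq = cong (inner _) (toℕ-injective eq)

  rank-injective : ∀ x y → rank x ≢ 0 → rank x ≡ rank y → x ≡ y
  rank-injective (original _) _ x≢0 _ = contradiction refl x≢0
  rank-injective (inner _ _) (original _) _ ()
  rank-injective (inner e i) (inner e′ j) _ eq
    with e≡ , i≡ ← combine-injective (combine (src e) (tgt e)) (inject≤ i (len≤ e)) _ (inject≤ j (len≤ e′))
                     (toℕ-injective (ℕ.suc-injective eq))
    with s≡ , t≡ ← combine-injective (src e) (tgt e) (src e′) (tgt e′) e≡
    = inner-≡ s≡ t≡ (trans (sym (toℕ-inject≤ i (len≤ e)))
        (trans (cong toℕ i≡) (toℕ-inject≤ j (len≤ e′))))

  place-injective : ∀ x y → rank x ≡ 0 → place x ≡ place y → x ≡ y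
  place-injective (original _) (original _) _ eq = cong original (leaf-injective eq)
  place-injective (original v) (inner e i)  _ eq = contradiction (sym eq) (ℕ.<⇒≢ (inner<leaf e i v))

  rank-next : ∀ e i j → toℕ j ≡ suc (toℕ i) → rank (inner e j) ≡ suc (rank (inner e i))
  rank-next e i j j≡1+i
    rewrite toℕ-combine (combine (src e) (tgt e)) (inject≤ i (len≤ e))
          | toℕ-combine (combine (src e) (tgt e)) (inject≤ j (len≤ e))
          | toℕ-inject≤ i (len≤ e) | toℕ-inject≤ j (len≤ e) | j≡1+i
    = cong suc (ℕ.+-suc _ (toℕ i))

  follows-consecutive : ∀ {x y} → Follows H len x y ⊎ Follows H len y x →
    rank x ≢ 0 → rank x < rank y → rank y ≡ suc (rank x)
  follows-consecutive (inj₁ (direct _ _))   x≢0 _ = contradiction refl x≢0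
  follows-consecutive (inj₁ (first _ _ _))  x≢0 _ = contradiction refl x≢0
  follows-consecutive (inj₁ (next e i j p)) _   _ = rank-next e i j p
  -- Going backwards along the path the rank drops, against `x<y`.
  follows-consecutive (inj₂ (next e i j p)) _   x<y =
    contradiction (ℕ.≤-<-trans (ℕ.n≤1+n _) (subst (_< rank (inner e i)) (rank-next e i j p) x<y))
                  (ℕ.<-irrefl refl)
  follows-consecutive (inj₂ (direct _ _)) x≢0 _ = contradiction refl x≢0
  follows-consecutive (inj₂ (last _ _ _)) x≢0 _ = contradiction refl x≢0

  black⇒follows : ∀ x y → status G x y ≡ black →
    Follows H len (from x) (from y) ⊎ Follows H len (from y) (from x)
  black⇒follows x y xy = Equivalence.to (adjacent (from x) (from y))
    (trans (cong₂ (status G) (strictlyInverseˡ x) (strictlyInverseˡ y)) xy)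

  from-injective : ∀ {x y} → from x ≡ from y → x ≡ y
  from-injective eq = trans (sym (strictlyInverseˡ _)) (trans (cong to eq) (strictlyInverseˡ _))

  black-near : ∀ x y → status G x y ≡ black → Near (place (from x)) (place (from y))
  black-near x y xy with black⇒follows x y xy
  ... | inj₁ f = follows-near f
  ... | inj₂ f = near-sym (follows-near f)

  sequence : IsGraph G → DSequence 4 G
  sequence isGraph = Folding.sequence G (place ∘ from) (rank ∘ from) isGraph black-near
    (λ x≢0 eq → from-injective (rank-injective _ _ x≢0 eq))
    (λ x≡0 eq → from-injective (place-injective _ _ x≡0 eq))
    (λ {x} {y} xy → follows-consecutive (black⇒follows x y xy))

-- The bound on `len` is 2 log n ≤ len e (base 2) with both sides exponentiated.
theorem1p2 : (n m : ℕ) (H : Trigraph n) (G : Trigraph (suc m)) →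
    IsGraph H → IsGraph G →
    (len : Edge H → ℕ) →
    (∀ e → n ^ 2 ≤ 2 ^ len e) →
    IsSubdivision H len G →
    tww G ≤ 4
theorem1p2 n m H G _ isGraph len long subdivision =
  tww-least G 4 (Subdivided.sequence H G len long subdivision isGraph)
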